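{- Let $G$ be a finite simple graph with distinguishing number $D(G)=2$ and determining number $Det(G)=2$. Then its cost number satisfies $2\le \rho(G)\le 4$.
   Context: For a graph $G$, $Aut(G)$ is its automorphism group. A vertex coloring $c:V(G)\to C$ (not necessarily proper) is distinguishing if the only automorphism $\varphi$ of $G$ with $c(\varphi(v))=c(v)$ for all $v$ is the identity. $D(G)$ is the least number of colors in a distinguishing coloring. A set $S\subseteq V(G)$ is a determining set if the only automorphism fixing every vertex of $S$ is the identity; $Det(G)$ is the minimum size of a determining set. If $D(G)=2$, a color class of a distinguishing coloring with 2 colors is called a distinguishing class, and the cost number $\rho(G)$ is the minimum size of a distinguishing class of $G$. -}

module Defs where

open import Data.Nat using (ℕ; _≤_; _<_)
open import Data.Bool using (Bool; true; false)
open import Data.Fin using (Fin; _≟_)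
open import Data.Fin.Subset using (Subset; _∈_; ∣_∣)
open import Data.Vec using (tabulate)
open import Data.Product using (Σ; _×_; ∃)
open import Relation.Nullary using (¬_)
open import Relation.Nullary.Decidable using (⌊_⌋)
open import Relation.Binary.PropositionalEquality using (_≡_)

record Graph (n : ℕ) : Set where
  field
    adj   : Fin n → Fin n → Bool
    sym   : ∀ u v → adj u v ≡ adj v u
    irrefl : ∀ v → adj v v ≡ false
open Graph public

record Aut {n : ℕ} (G : Graph n) : Set where
  field
    fun     : Fin n → Fin n
    inv     : Fin n → Fin n
    inv-l   : ∀ v → inv (fun v) ≡ v
    inv-r   : ∀ v → fun (inv v) ≡ v
    preserv : ∀ u v → adj G (fun u) (fun v) ≡ adj G u v
open Aut public

IsIdentity : ∀ {n} {G : Graph n} → Aut G → Set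
IsIdentity φ = ∀ v → fun φ v ≡ v

Distinguishing : ∀ {n} (G : Graph n) {k : ℕ} → (Fin n → Fin k) → Set
Distinguishing G c = ∀ (φ : Aut G) → (∀ v → c (fun φ v) ≡ c v) → IsIdentity φ

HasDistColoring : ∀ {n} → Graph n → ℕ → Set
HasDistColoring {n} G k = Σ (Fin n → Fin k) (Distinguishing G)

DistNumberIs : ∀ {n} → Graph n → ℕ → Set
DistNumberIs G d = HasDistColoring G d × (∀ k → k < d → ¬ HasDistColoring G k)

Determining : ∀ {n} (G : Graph n) → Subset n → Set
Determining G S = ∀ (φ : Aut G) → (∀ v → v ∈ S → fun φ v ≡ v) → IsIdentity φ

DetNumberIs : ∀ {n} → Graph n → ℕ → Set
DetNumberIs G d =
  (Σ _ λ S → Determining G S × ∣ S ∣ ≡ d) × (∀ S → Determining G S → d ≤ ∣ S ∣)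

colorClass : ∀ {n k} → (Fin n → Fin k) → Fin k → Subset n
colorClass c i = tabulate (λ v → ⌊ c v ≟ i ⌋)

DistClass : ∀ {n} → Graph n → Subset n → Set
DistClass G S = Σ (Fin _ → Fin 2) λ c → Distinguishing G c × Σ (Fin 2) λ i → colorClass c i ≡ S

CostNumberIs : ∀ {n} → Graph n → ℕ → Set
CostNumberIs G r =
  (Σ _ λ S → DistClass G S × ∣ S ∣ ≡ r) × (∀ S → DistClass G S → r ≤ ∣ S ∣)

{-# OPTIONS --safe #-}
module Submission where

-- A subset S is a distinguishing class exactly when it is rigid: only the identity
-- preserves it setwise.  Rigid sets are determining, whence 2 ≤ ρ.
--
-- For the upper bound let {a, b} be a determining set, write x ~ y when (x, y) is an
-- image of (a, b) under an automorphism, and suppose no set of at most four vertices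
-- is rigid.  An automorphism is determined by its values at x and y whenever x ~ y.
-- The sets {x, y} show that every arc is reversed by an automorphism; the sets
-- {x, y, z}, that this swap fixes every vertex adjacent in ~ to neither x nor y; and
-- the sets {x, y, z, w}, that a ~-neighbour x of y is nonadjacent to at most one other
-- ~-neighbour of y.  If ~ has no induced path, then a, b and a third vertex are pairwise
-- twins of G, so two colours do not distinguish them.  If x y z is an induced path and
-- y has a further neighbour w, then x and z are twins and their transposition fixes
-- y and w, which is absurd.  Otherwise ~ is a 4-cycle or a 5-cycle whose edge swaps fix
-- all other vertices, and no 2-colouring is distinguishing.

open import Defs hiding (sym)
open import Data.Bool using (Bool; true; false)
import Data.Bool.Properties as Bool
open import Data.Empty using (⊥; ⊥-elim)
open import Data.Fin using (Fin; zero; suc; _≟_)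
open import Data.Fin.Properties using (any?; all?)
open import Data.Fin.Permutation.Components using (transpose; transpose-inverse)
open import Data.List using (List; []; _∷_; length; map)
open import Data.List.Membership.Propositional using () renaming (_∈_ to _∈ₗ_)
open import Data.List.Membership.Propositional.Properties using (∈-map⁺)
open import Data.List.Properties using (length-map)
open import Data.List.Relation.Unary.Any using (here; there)
open import Data.Fin.Subset using (Subset; _∈_; ∣_∣; ⁅_⁆; _∪_; inside; outside) renaming (⊥ to ∅)
open import Data.Fin.Subset.Properties using (∉⊥; ∣⊥∣≡0; ∣⁅x⁆∣≡1; x∈⁅x⁆; x∈⁅y⁆⇒x≡y; x∈p∪q⁺; x∈p∪q⁻; anySubset?)
open import Data.Nat using (ℕ; zero; suc; _+_; _≤_; _<_; z≤n; s≤s)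
open import Data.Nat.Induction using (<-rec)
open import Data.Nat.Properties using (≤-refl; ≤-trans; ≤-reflexive; <⇒≤; ≮⇒≥; anyUpTo?; n≤1+n; _≤?_; +-monoʳ-≤; +-suc; module ≤-Reasoning) renaming (_≟_ to _≟ℕ_)
open import Data.Product using (Σ; ∃; _×_; _,_)
open import Data.Sum using (_⊎_; inj₁; inj₂; [_,_]′)
open import Data.Unit using (tt)
open import Data.Vec using (Vec; []; _∷_; lookup; tabulate; here; there)
open import Data.Vec.Properties using (lookup∘tabulate; tabulate∘lookup; tabulate-cong; []=⇒lookup; lookup⇒[]=)
open import Function using (_∘_; id)
open import Relation.Binary.PropositionalEquality using (_≡_; _≢_; refl; sym; trans; cong; cong₂; subst₂)
open import Relation.Nullary using (¬_; Dec; yes; no; contradiction)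
open import Relation.Nullary.Decidable using (⌊_⌋; map′; toWitness; _×-dec_; _⊎-dec_; _→-dec_; ¬?; decidable-stable)

private
  variable
    n : ℕ

-- Transpositions, pigeonhole and two-colourings of short cycles.

transpose-matchˡ : (x y : Fin n) → transpose x y x ≡ y
transpose-matchˡ x y with x ≟ x
... | yes _  = refl
... | no x≢x = ⊥-elim (x≢x refl)

transpose-matchʳ : (x y : Fin n) → transpose x y y ≡ x
transpose-matchʳ x y with y ≟ x
... | yes y≡x = y≡x
... | no _ with y ≟ y
...   | yes _  = refl
...   | no y≢y = ⊥-elim (y≢y refl)

transpose-mismatch : {x y v : Fin n} → v ≢ x → v ≢ y → transpose x y v ≡ v
transpose-mismatch {x = x} {y} {v} v≢x v≢y with v ≟ x
... | yes v≡x = ⊥-elim (v≢x v≡x)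
... | no _ with v ≟ y
...   | yes v≡y = ⊥-elim (v≢y v≡y)
...   | no _    = refl

data Position (x y v : Fin n) : Set where
  first   : v ≡ x → Position x y v
  second  : v ≡ y → Position x y v
  neither : v ≢ x → v ≢ y → Position x y v

position : (x y v : Fin n) → Position x y v
position x y v with v ≟ x
... | yes v≡x = first v≡x
... | no v≢x with v ≟ y
...   | yes v≡y = second v≡y
...   | no v≢y  = neither v≢x v≢y

transpose-comm : (x y v : Fin n) → transpose x y v ≡ transpose y x v
transpose-comm x y v with position x y v
... | first refl      = trans (transpose-matchˡ x y) (sym (transpose-matchʳ y x))
... | second refl     = trans (transpose-matchʳ x y) (sym (transpose-matchˡ y x))
... | neither v≢x v≢y = trans (transpose-mismatch v≢x v≢y) (sym (transpose-mismatch v≢y v≢x))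

-- Pigeonhole, applied to images of vertices in `unique-non-neighbour` and to two colours on a
-- triangle in `no-distinguishing`.
three-in-two : {A : Set} {x y z p q : A} → x ≢ y → x ≢ z → y ≢ z →
  x ≡ p ⊎ x ≡ q → y ≡ p ⊎ y ≡ q → z ≡ p ⊎ z ≡ q → ⊥
three-in-two x≢y x≢z y≢z (inj₁ a) (inj₁ b) c        = x≢y (trans a (sym b))
three-in-two x≢y x≢z y≢z (inj₁ a) (inj₂ b) (inj₁ c) = x≢z (trans a (sym c))
three-in-two x≢y x≢z y≢z (inj₁ a) (inj₂ b) (inj₂ c) = y≢z (trans b (sym c))
three-in-two x≢y x≢z y≢z (inj₂ a) (inj₂ b) c        = x≢y (trans a (sym b))
three-in-two x≢y x≢z y≢z (inj₂ a) (inj₁ b) (inj₂ c) = x≢z (trans a (sym c))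
three-in-two x≢y x≢z y≢z (inj₂ a) (inj₁ b) (inj₁ c) = y≢z (trans b (sym c))

fin₂ : (i : Fin 2) → i ≡ zero ⊎ i ≡ suc zero
fin₂ zero       = inj₁ refl
fin₂ (suc zero) = inj₂ refl

-- If both opposite pairs differ, `q` equals `p` or `r` and `s` equals the other, so a reflection
-- exchanging adjacent vertices preserves the colours.
4-cycle-colouring : (p q r s : Fin 2) → p ≡ r ⊎ q ≡ s ⊎ (q ≡ r × p ≡ s) ⊎ (q ≡ p × r ≡ s)
4-cycle-colouring = toWitness
  {a? = all? λ p → all? λ q → all? λ r → all? λ s →
    (p ≟ r) ⊎-dec (q ≟ s) ⊎-dec ((q ≟ r) ×-dec (p ≟ s)) ⊎-dec ((q ≟ p) ×-dec (r ≟ s))} tt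

-- The alternatives are the five reflections of a pentagon: every two-colouring is symmetric under
-- one of them.
5-cycle-colouring : (p q r s t : Fin 2) →
  (q ≡ r × p ≡ s) ⊎ (r ≡ s × q ≡ t) ⊎ (s ≡ t × r ≡ p) ⊎ (t ≡ p × s ≡ q) ⊎ (p ≡ q × t ≡ r)
5-cycle-colouring = toWitness
  {a? = all? λ p → all? λ q → all? λ r → all? λ s → all? λ t →
    ((q ≟ r) ×-dec (p ≟ s)) ⊎-dec ((r ≟ s) ×-dec (q ≟ t)) ⊎-dec ((s ≟ t) ×-dec (r ≟ p)) ⊎-dec
    ((t ≟ p) ×-dec (s ≟ q)) ⊎-dec ((p ≟ q) ×-dec (t ≟ r))} tt

-- The group of automorphisms.

module _ {G : Graph n} where

  idᴬ : Aut G
  idᴬ = record { fun = id ; inv = id ; inv-l = λ _ → refl ; inv-r = λ _ → refl ; preserv = λ _ _ → refl }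

  infixr 9 _∘ᴬ_
  _∘ᴬ_ : Aut G → Aut G → Aut G
  φ ∘ᴬ ψ = record
    { fun     = fun φ ∘ fun ψ
    ; inv     = inv ψ ∘ inv φ
    ; inv-l   = λ v → trans (cong (inv ψ) (inv-l φ _)) (inv-l ψ v)
    ; inv-r   = λ v → trans (cong (fun φ) (inv-r ψ _)) (inv-r φ v)
    ; preserv = λ u v → trans (preserv φ _ _) (preserv ψ u v)
    }

  infix 10 _⁻¹
  _⁻¹ : Aut G → Aut G
  φ ⁻¹ = record
    { fun     = inv φ
    ; inv     = fun φ
    ; inv-l   = inv-r φ
    ; inv-r   = inv-l φ
    ; preserv = λ u v → trans (sym (preserv φ _ _)) (cong₂ (adj G) (inv-r φ u) (inv-r φ v))
    }

  fun-injective : (φ : Aut G) {u v : Fin n} → fun φ u ≡ fun φ v → u ≡ v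
  fun-injective φ {u} {v} e = trans (sym (inv-l φ u)) (trans (cong (inv φ) e) (inv-l φ v))

  inv-eq : (φ : Aut G) {u v : Fin n} → fun φ u ≡ v → inv φ v ≡ u
  inv-eq φ e = trans (cong (inv φ) (sym e)) (inv-l φ _)

-- Twin vertices, adjacent or not, and their transposition.

Twins : (G : Graph n) → Fin n → Fin n → Set
Twins G x y = ∀ v → v ≢ x → v ≢ y → adj G x v ≡ adj G y v

module _ {G : Graph n} {x y : Fin n} (twins : Twins G x y) where

  private
    τ : Fin n → Fin n
    τ = transpose x y

    adj-comm : ∀ u v → adj G u v ≡ adj G v u
    adj-comm = Graph.sym G

    τ-row : ∀ u v → v ≢ x → v ≢ y → adj G (τ u) v ≡ adj G u v
    τ-row u v v≢x v≢y with position x y u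
    ... | first refl      = trans (cong (λ t → adj G t v) (transpose-matchˡ x y)) (sym (twins v v≢x v≢y))
    ... | second refl     = trans (cong (λ t → adj G t v) (transpose-matchʳ x y)) (twins v v≢x v≢y)
    ... | neither u≢x u≢y = cong (λ t → adj G t v) (transpose-mismatch u≢x u≢y)

    τ-preserves : ∀ u v → adj G (τ u) (τ v) ≡ adj G u v
    τ-preserves u v with position x y u | position x y v
    ... | _ | neither v≢x v≢y =
      trans (cong (adj G (τ u)) (transpose-mismatch v≢x v≢y)) (τ-row u v v≢x v≢y)
    ... | neither u≢x u≢y | _ =
      trans (cong (λ t → adj G t (τ v)) (transpose-mismatch u≢x u≢y))
        (trans (adj-comm u (τ v)) (trans (τ-row v u u≢x u≢y) (adj-comm v u)))
    ... | first refl  | first refl  = trans (irrefl G (τ x)) (sym (irrefl G x))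
    ... | second refl | second refl = trans (irrefl G (τ y)) (sym (irrefl G y))
    ... | first refl  | second refl =
      trans (cong₂ (adj G) (transpose-matchˡ x y) (transpose-matchʳ x y)) (adj-comm y x)
    ... | second refl | first refl  =
      trans (cong₂ (adj G) (transpose-matchʳ x y) (transpose-matchˡ x y)) (adj-comm x y)

  swapTwins : Aut G
  swapTwins = record
    { fun     = τ
    ; inv     = τ
    ; inv-l   = involutive
    ; inv-r   = involutive
    ; preserv = τ-preserves
    }
    where
    involutive : ∀ v → τ (τ v) ≡ v
    involutive v = trans (cong τ (transpose-comm x y v)) (transpose-inverse x y)

  -- On twins of equal colour the transposition would be a nontrivial colour-preserving
  -- automorphism.
  distinguishing⇒twins-differ : ∀ {k} {c : Fin n → Fin k} → Distinguishing G c → x ≢ y → c x ≢ c y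
  distinguishing⇒twins-differ {c = c} dist x≢y cx≡cy =
    x≢y (trans (sym (dist swapTwins preserves x)) (transpose-matchˡ x y))
    where
    preserves : ∀ v → c (τ v) ≡ c v
    preserves v with position x y v
    ... | first refl      = trans (cong c (transpose-matchˡ x y)) (sym cx≡cy)
    ... | second refl     = trans (cong c (transpose-matchʳ x y)) cx≡cy
    ... | neither v≢x v≢y = cong c (transpose-mismatch v≢x v≢y)

-- The orbital graph of a determining pair.

module Arcs
  (G : Graph n) (a b : Fin n)
  (base : ∀ (φ : Aut G) → fun φ a ≡ a → fun φ b ≡ b → IsIdentity φ)
  -- The assumption to be refuted: no set of at most four vertices is rigid. Mapping `L` into itself
  -- suffices, as `ψ` is injective and `L` finite.
  (stabilizer : ∀ (L : List (Fin n)) → length L ≤ 4 →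
    Σ (Aut G) λ ψ → ¬ IsIdentity ψ × (∀ {v} → v ∈ₗ L → fun ψ v ∈ₗ L))
  where

  infix 4 _~_
  -- The orbital of `(a, b)`. It is invariant under automorphisms by construction, but symmetric
  -- only thanks to `swap-base`.
  _~_ : Fin n → Fin n → Set
  x ~ y = Σ (Aut G) λ φ → fun φ a ≡ x × fun φ b ≡ y

  a~b : a ~ b
  a~b = idᴬ , refl , refl

  ~-image : ∀ (φ : Aut G) {x y} → x ~ y → fun φ x ~ fun φ y
  ~-image φ (θ , p , q) = φ ∘ᴬ θ , cong (fun φ) p , cong (fun φ) q

  ~-map : ∀ (φ : Aut G) {x y x′ y′} → fun φ x ≡ x′ → fun φ y ≡ y′ → x ~ y → x′ ~ y′
  ~-map φ p q x~y = subst₂ _~_ p q (~-image φ x~y)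

  ~-preimage : ∀ (φ : Aut G) {x y x′ y′} → fun φ x ≡ x′ → fun φ y ≡ y′ → x′ ~ y′ → x ~ y
  ~-preimage φ p q = ~-map (φ ⁻¹) (inv-eq φ p) (inv-eq φ q)

  adj-const : ∀ {x y x′ y′} → x ~ y → x′ ~ y′ → adj G x y ≡ adj G x′ y′
  adj-const (θ , refl , refl) (θ′ , refl , refl) = trans (preserv θ _ _) (sym (preserv θ′ _ _))

  -- Conjugating `φ` by `θ` gives an automorphism fixing `a` and `b`, to which `base` applies.
  ~-fixed : ∀ {x y} → x ~ y → (φ : Aut G) → fun φ x ≡ x → fun φ y ≡ y → IsIdentity φ
  ~-fixed (θ , refl , refl) φ p q v =
    trans (cong (fun φ) (sym (inv-r θ v))) (trans (sym (inv-r θ _))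
      (trans (cong (fun θ) (base (θ ⁻¹ ∘ᴬ φ ∘ᴬ θ) (inv-eq θ (sym p)) (inv-eq θ (sym q)) (inv θ v)))
        (inv-r θ v)))

  -- Transfers what is known of a stabilizing `ψ` to any given `φ` that agrees with it on one arc.
  ~-determines : ∀ {x y} → x ~ y → (φ ψ : Aut G) →
    fun φ x ≡ fun ψ x → fun φ y ≡ fun ψ y → ∀ v → fun φ v ≡ fun ψ v
  ~-determines x~y φ ψ p q v =
    trans (sym (inv-r ψ _)) (cong (fun ψ) (~-fixed x~y (ψ ⁻¹ ∘ᴬ φ) (inv-eq ψ (sym p)) (inv-eq ψ (sym q)) v))

  a≢b : a ≢ b
  a≢b a≡b with stabilizer (a ∷ []) (s≤s z≤n)
  ... | ψ , ψ≢id , stab with stab (here refl)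
  ...   | here e = ψ≢id (base ψ e (trans (cong (fun ψ) (sym a≡b)) (trans e a≡b)))

  ~⇒≢ : ∀ {x y} → x ~ y → x ≢ y
  ~⇒≢ (θ , refl , refl) e = a≢b (fun-injective θ e)

  ~-irrefl : ∀ {x} → ¬ x ~ x
  ~-irrefl x~x = ~⇒≢ x~x refl

  -- A nontrivial automorphism preserving the pair cannot fix both of its vertices, so it exchanges
  -- them.
  swap-base : Σ (Aut G) λ ψ → fun ψ a ≡ b × fun ψ b ≡ a
  swap-base with stabilizer (a ∷ b ∷ []) (s≤s (s≤s z≤n))
  ... | ψ , ψ≢id , stab with stab (here refl) | stab (there (here refl))
  ... | here p         | here q         = ⊥-elim (a≢b (fun-injective ψ (trans p (sym q))))
  ... | there (here p) | there (here q) = ⊥-elim (a≢b (fun-injective ψ (trans p (sym q))))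
  ... | here p         | there (here q) = ⊥-elim (ψ≢id (base ψ p q))
  ... | there (here p) | here q         = ψ , p , q

  ~-sym : ∀ {x y} → x ~ y → y ~ x
  ~-sym (θ , p , q) with swap-base
  ... | ψ , r , s = θ ∘ᴬ ψ , trans (cong (fun θ) r) q , trans (cong (fun θ) s) p

  swap : ∀ {x y} → x ~ y → Σ (Aut G) λ ψ → fun ψ x ≡ y × fun ψ y ≡ x
  swap (θ , refl , refl) with swap-base
  ... | ψ , r , s = θ ∘ᴬ ψ ∘ᴬ θ ⁻¹ ,
    cong (fun θ) (trans (cong (fun ψ) (inv-l θ a)) r) ,
    cong (fun θ) (trans (cong (fun ψ) (inv-l θ b)) s)

  -- Within the three vertices `z` is isolated in `~` while `x` and `y` are joined. So a nontrivial
  -- stabilizing `ψ` swaps `x` with `y` and fixes `z`, and `φ` agrees with `ψ` on the arc.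
  swap-fixes : ∀ {x y z} → x ~ y → ¬ x ~ z → ¬ y ~ z → z ≢ x → z ≢ y →
    (φ : Aut G) → fun φ x ≡ y → fun φ y ≡ x → fun φ z ≡ z
  swap-fixes {x} {y} {z} x~y x≁z y≁z z≢x z≢y φ φx φy
    with stabilizer (x ∷ y ∷ z ∷ []) (s≤s (s≤s (s≤s z≤n)))
  ... | ψ , ψ≢id , stab = finish (image (stab (here refl)) ψx≢z)
                                 (image (stab (there (here refl))) ψy≢z)
                                 (stab (there (there (here refl))))
    where
    L = x ∷ y ∷ z ∷ []
    x≢y = ~⇒≢ x~y

    ψ-inj : ∀ {u v t} → fun ψ u ≡ t → fun ψ v ≡ t → u ≡ v
    ψ-inj p q = fun-injective ψ (trans p (sym q))

    z-isolated : ∀ {v} → v ∈ₗ L → ¬ z ~ v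
    z-isolated (here refl)                 = x≁z ∘ ~-sym
    z-isolated (there (here refl))         = y≁z ∘ ~-sym
    z-isolated (there (there (here refl))) = ~-irrefl

    ψx≢z : fun ψ x ≢ z
    ψx≢z e = z-isolated (stab (there (here refl))) (~-map ψ e refl x~y)

    ψy≢z : fun ψ y ≢ z
    ψy≢z e = z-isolated (stab (here refl)) (~-map ψ e refl (~-sym x~y))

    image : ∀ {v} → v ∈ₗ L → v ≢ z → v ≡ x ⊎ v ≡ y
    image (here p)                 _ = inj₁ p
    image (there (here p))         _ = inj₂ p
    image (there (there (here p))) q = ⊥-elim (q p)

    finish : fun ψ x ≡ x ⊎ fun ψ x ≡ y → fun ψ y ≡ x ⊎ fun ψ y ≡ y → fun ψ z ∈ₗ L → fun φ z ≡ z
    finish (inj₁ p) (inj₁ q) _ = ⊥-elim (x≢y (ψ-inj p q))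
    finish (inj₂ p) (inj₂ q) _ = ⊥-elim (x≢y (ψ-inj p q))
    finish (inj₁ p) (inj₂ q) _ = ⊥-elim (ψ≢id (~-fixed x~y ψ p q))
    finish (inj₂ p) (inj₁ q) (here r)                 = ⊥-elim (z≢y (ψ-inj r q))
    finish (inj₂ p) (inj₁ q) (there (here r))         = ⊥-elim (z≢x (ψ-inj r p))
    finish (inj₂ p) (inj₁ q) (there (there (here r))) =
      trans (~-determines x~y φ ψ (trans φx (sym p)) (trans φy (sym q)) z) r

  -- Both endpoints of the second arc would be fixed by the swap of the first.
  no-disjoint-arcs : ∀ {x y z w} → x ~ y → z ~ w → z ≢ x → z ≢ y → w ≢ x → w ≢ y →
    ¬ x ~ z → ¬ y ~ z → ¬ x ~ w → ¬ y ~ w → ⊥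
  no-disjoint-arcs x~y z~w z≢x z≢y w≢x w≢y x≁z y≁z x≁w y≁w with swap x~y
  ... | φ , p , q = ~⇒≢ x~y (trans (sym (~-fixed z~w φ
          (swap-fixes x~y x≁z y≁z z≢x z≢y φ p q) (swap-fixes x~y x≁w y≁w w≢x w≢y φ p q) _)) p)

  adj-swap : ∀ {x y v} → x ~ y → ¬ x ~ v → ¬ y ~ v → v ≢ x → v ≢ y → adj G x v ≡ adj G y v
  adj-swap x~y x≁v y≁v v≢x v≢y with swap x~y
  ... | φ , p , q = trans (sym (preserv φ _ _)) (cong₂ (adj G) p (swap-fixes x~y x≁v y≁v v≢x v≢y φ p q))

  -- Induced paths in the orbital graph.

  record InducedPath (x y z : Fin n) : Set where
    field
      left    : y ~ x
      right   : y ~ z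
      ends-≢  : x ≢ z
      ends-≁  : ¬ x ~ z
  open InducedPath

  InducedPath-sym : ∀ {x y z} → InducedPath x y z → InducedPath z y x
  InducedPath-sym P = record
    { left = right P ; right = left P ; ends-≢ = ends-≢ P ∘ sym ; ends-≁ = ends-≁ P ∘ ~-sym }

  -- A stabilizing `ψ` fixes the centre, the only vertex joined to both others. Being nontrivial it
  -- exchanges the ends, and `φ` agrees with it on the arc from `y` to `x`.
  path-flip : ∀ {x y z} → InducedPath x y z → (φ : Aut G) → fun φ y ≡ y → fun φ x ≡ z → fun φ z ≡ x
  path-flip {x} {y} {z} P φ φy φx
    with stabilizer (x ∷ y ∷ z ∷ []) (s≤s (s≤s (s≤s z≤n)))
  ... | ψ , ψ≢id , stab = centre (stab (there (here refl)))
    where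
    L = x ∷ y ∷ z ∷ []

    ψ-inj : ∀ {u v t} → fun ψ u ≡ t → fun ψ v ≡ t → u ≡ v
    ψ-inj p q = fun-injective ψ (trans p (sym q))

    only-y : ∀ {u v} → u ≡ x ⊎ u ≡ z → v ∈ₗ L → u ~ v → v ≡ y
    only-y (inj₁ refl) (here refl)                 u~v = ⊥-elim (~-irrefl u~v)
    only-y (inj₂ refl) (here refl)                 u~v = ⊥-elim (ends-≁ P (~-sym u~v))
    only-y _           (there (here p))            u~v = p
    only-y (inj₁ refl) (there (there (here refl))) u~v = ⊥-elim (ends-≁ P u~v)
    only-y (inj₂ refl) (there (there (here refl))) u~v = ⊥-elim (~-irrefl u~v)

    -- Both end images would be neighbours of an end within `L`, and `y` is the only one.
    not-end : fun ψ y ≡ x ⊎ fun ψ y ≡ z → ⊥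
    not-end e = ends-≢ P (ψ-inj
      (only-y e (stab (here refl)) (~-image ψ (left P)))
      (only-y e (stab (there (there (here refl)))) (~-image ψ (right P))))

    finish : fun ψ y ≡ y → fun ψ x ∈ₗ L → fun ψ z ∈ₗ L → fun φ z ≡ x
    finish r (here p)                 _ = ⊥-elim (ψ≢id (~-fixed (left P) ψ r p))
    finish r (there (here p))         _ = ⊥-elim (~⇒≢ (left P) (ψ-inj r p))
    finish r (there (there (here p))) (there (here q))         = ⊥-elim (~⇒≢ (right P) (ψ-inj r q))
    finish r (there (there (here p))) (there (there (here q))) = ⊥-elim (ends-≢ P (ψ-inj p q))
    finish r (there (there (here p))) (here q) =
      trans (~-determines (left P) φ ψ (trans φy (sym r)) (trans φx (sym p)) z) q

    centre : fun ψ y ∈ₗ L → fun φ z ≡ x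
    centre (here e)                 = ⊥-elim (not-end (inj₁ e))
    centre (there (here e))         = finish e (stab (here refl)) (stab (there (there (here refl))))
    centre (there (there (here e))) = ⊥-elim (not-end (inj₂ e))

  -- In {x, y, z, w} only y is joined to all the others, so a stabilizing ψ fixes y;
  -- if it moves x to z or w it flips that path and fixes the remaining vertex.
  unique-non-neighbour : ∀ {x y z w} → InducedPath x y z → InducedPath x y w → z ≢ w → ⊥
  unique-non-neighbour {x} {y} {z} {w} P Q z≢w
    with stabilizer (y ∷ x ∷ z ∷ w ∷ []) (s≤s (s≤s (s≤s (s≤s z≤n))))
  ... | ψ , ψ≢id , stab = centre (stab y∈)
    where
    L = y ∷ x ∷ z ∷ w ∷ []

    y∈ : y ∈ₗ L
    y∈ = here refl
    x∈ : x ∈ₗ L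
    x∈ = there (here refl)
    z∈ : z ∈ₗ L
    z∈ = there (there (here refl))
    w∈ : w ∈ₗ L
    w∈ = there (there (there (here refl)))

    ψ-inj : ∀ {u v t} → fun ψ u ≡ t → fun ψ v ≡ t → u ≡ v
    ψ-inj p q = fun-injective ψ (trans p (sym q))

    -- The repeated alternative gives `near-x` the shape that `not-centre` expects.
    near-x : ∀ {v} → v ∈ₗ L → x ~ v → v ≡ y ⊎ v ≡ y
    near-x (here p)                            _   = inj₁ p
    near-x (there (here refl))                 x~v = ⊥-elim (~-irrefl x~v)
    near-x (there (there (here refl)))         x~v = ⊥-elim (ends-≁ P x~v)
    near-x (there (there (there (here refl)))) x~v = ⊥-elim (ends-≁ Q x~v)

    near-z : ∀ {v} → v ∈ₗ L → z ~ v → v ≡ y ⊎ v ≡ w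
    near-z (here p)                         _   = inj₁ p
    near-z (there (here refl))              z~v = ⊥-elim (ends-≁ P (~-sym z~v))
    near-z (there (there (here refl)))      z~v = ⊥-elim (~-irrefl z~v)
    near-z (there (there (there (here p)))) _   = inj₂ p

    near-w : ∀ {v} → v ∈ₗ L → w ~ v → v ≡ y ⊎ v ≡ z
    near-w (here p)                            _   = inj₁ p
    near-w (there (here refl))                 w~v = ⊥-elim (ends-≁ Q (~-sym w~v))
    near-w (there (there (here p)))            _   = inj₂ p
    near-w (there (there (there (here refl)))) w~v = ⊥-elim (~-irrefl w~v)

    -- The images of `x`, `z`, `w` would be three distinct neighbours of `u` among only two
    -- candidates.
    not-centre : ∀ {u p q} → fun ψ y ≡ u → (∀ {v} → v ∈ₗ L → u ~ v → v ≡ p ⊎ v ≡ q) → ⊥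
    not-centre refl near = three-in-two
      (ends-≢ P ∘ fun-injective ψ) (ends-≢ Q ∘ fun-injective ψ) (z≢w ∘ fun-injective ψ)
      (near (stab x∈) (~-image ψ (left P)))
      (near (stab z∈) (~-image ψ (right P)))
      (near (stab w∈) (~-image ψ (right Q)))

    module _ (ψy : fun ψ y ≡ y) where

      fixed-w : fun ψ x ≡ z → fun ψ z ≡ x → fun ψ w ∈ₗ L → ⊥
      fixed-w p q (here r)                         = ~⇒≢ (right Q) (ψ-inj ψy r)
      fixed-w p q (there (here r))                 = z≢w (ψ-inj q r)
      fixed-w p q (there (there (here r)))         = ends-≢ Q (ψ-inj p r)
      fixed-w p q (there (there (there (here r)))) = ψ≢id (~-fixed (right Q) ψ ψy r)

      fixed-z : fun ψ x ≡ w → fun ψ w ≡ x → fun ψ z ∈ₗ L → ⊥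
      fixed-z p q (here r)                         = ~⇒≢ (right P) (ψ-inj ψy r)
      fixed-z p q (there (here r))                 = z≢w (ψ-inj r q)
      fixed-z p q (there (there (here r)))         = ψ≢id (~-fixed (right P) ψ ψy r)
      fixed-z p q (there (there (there (here r)))) = ends-≢ P (ψ-inj p r)

      image-x : fun ψ x ∈ₗ L → ⊥
      image-x (here p)                         = ~⇒≢ (left P) (ψ-inj ψy p)
      image-x (there (here p))                 = ψ≢id (~-fixed (left P) ψ ψy p)
      image-x (there (there (here p)))         = fixed-w p (path-flip P ψ ψy p) (stab w∈)
      image-x (there (there (there (here p)))) = fixed-z p (path-flip Q ψ ψy p) (stab z∈)

    centre : fun ψ y ∈ₗ L → ⊥
    centre (here e)                         = image-x e (stab x∈)
    centre (there (here e))                 = not-centre e near-x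
    centre (there (there (here e)))         = not-centre e near-z
    centre (there (there (there (here e)))) = not-centre e near-w

  -- The valency of the centre of an induced path.

  module _ (_~?_ : ∀ x y → Dec (x ~ y)) where

    -- Otherwise `x` would miss both `z` and `w`, against `unique-non-neighbour`.
    path-third : ∀ {x y z w} → InducedPath x y z → y ~ w → w ≢ x → w ≢ z → x ~ w
    path-third {x} {w = w} P y~w w≢x w≢z with x ~? w
    ... | yes x~w = x~w
    ... | no x≁w  = ⊥-elim (unique-non-neighbour P
      (record { left = left P ; right = y~w ; ends-≢ = w≢x ∘ sym ; ends-≁ = x≁w }) (w≢z ∘ sym))

    -- A vertex joined to `x` is joined to `z`, and `G`-adjacency is constant on arcs. A vertex not
    -- joined to `x` is joined to neither `y` nor `z`, so the swaps along `x y` and `y z` fix it and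
    -- carry its adjacency over.
    twins-criterion : ∀ {x y z} → y ~ x → y ~ z →
      (∀ {v} → v ≢ x → v ≢ z → x ~ v → z ~ v) →
      (∀ {v} → v ≢ x → v ≢ z → z ~ v → x ~ v) →
      (∀ {v} → v ≢ x → v ≢ z → y ~ v → x ~ v) →
      Twins G x z
    twins-criterion {x} {y} {z} y~x y~z x⇒z z⇒x y⇒x v v≢x v≢z with x ~? v
    ... | yes x~v = adj-const x~v (x⇒z v≢x v≢z x~v)
    ... | no x≁v  = trans (adj-swap (~-sym y~x) x≁v y≁v v≢x v≢y) (adj-swap y~z y≁v z≁v v≢y v≢z)
      where
      y≁v : ¬ y ~ v
      y≁v = x≁v ∘ y⇒x v≢x v≢z
      z≁v : ¬ z ~ v
      z≁v = x≁v ∘ z⇒x v≢x v≢z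
      v≢y : v ≢ y
      v≢y refl = x≁v (~-sym y~x)

    -- If v ~ x but v is not joined to y, then w ~ v by the path y x v, and z ~ v by the path y w v.
    path-neighbours : ∀ {x y z w v} → InducedPath x y z → y ~ w → w ≢ x → w ≢ z →
      v ≢ x → v ≢ z → x ~ v → z ~ v
    path-neighbours {x} {y} {z} {w} {v} P y~w w≢x w≢z v≢x v≢z x~v with v ≟ y | y ~? v
    ... | yes refl | _       = ~-sym (right P)
    ... | no _     | yes y~v = path-third (InducedPath-sym P) y~v v≢z v≢x
    ... | no v≢y   | no y≁v  = ~-sym (path-third (InducedPath-sym Y-W-V) (~-sym z~w) (v≢z ∘ sym) (~⇒≢ (right P) ∘ sym))
      where
      x~w : x ~ w
      x~w = path-third P y~w w≢x w≢z
      z~w : z ~ w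
      z~w = path-third (InducedPath-sym P) y~w w≢z w≢x
      w≢v : w ≢ v
      w≢v refl = y≁v y~w
      Y-X-V : InducedPath y x v
      Y-X-V = record { left = ~-sym (left P) ; right = x~v ; ends-≢ = v≢y ∘ sym ; ends-≁ = y≁v }
      Y-W-V : InducedPath y w v
      Y-W-V = record
        { left   = ~-sym y~w
        ; right  = ~-sym (path-third (InducedPath-sym Y-X-V) x~w w≢v (~⇒≢ y~w ∘ sym))
        ; ends-≢ = v≢y ∘ sym
        ; ends-≁ = y≁v
        }

    -- The transposition of x and z would be an automorphism fixing the arc y ~ w.
    no-third-neighbour : ∀ {x y z w} → InducedPath x y z → y ~ w → w ≢ x → w ≢ z → ⊥
    no-third-neighbour {x} {y} {z} {w} P y~w w≢x w≢z = ends-≢ P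
      (trans (sym (~-fixed y~w (swapTwins twins)
        (transpose-mismatch (~⇒≢ (left P)) (~⇒≢ (right P))) (transpose-mismatch w≢x w≢z) x))
        (transpose-matchˡ x z))
      where
      twins : Twins G x z
      twins = twins-criterion (left P) (right P)
        (path-neighbours P y~w w≢x w≢z)
        (λ v≢x v≢z → path-neighbours (InducedPath-sym P) y~w w≢z w≢x v≢z v≢x)
        (λ v≢x v≢z y~v → path-third P y~v v≢x v≢z)

    path-only : ∀ {x y z w} → InducedPath x y z → y ~ w → w ≡ x ⊎ w ≡ z
    path-only {x} {y} {z} {w} P y~w with position x z w
    ... | first e         = inj₁ e
    ... | second e        = inj₂ e
    ... | neither w≢x w≢z = ⊥-elim (no-third-neighbour P y~w w≢x w≢z)

    -- Excluding the 4-cycle, the 5-cycle and complete components by a two-colouring.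

    module _ {c : Fin n → Fin 2} (dist : Distinguishing G c) where

      -- `colour` records that the swap of `y` and `z`, which also exchanges `x` with `next`, does
      -- not preserve the colouring.
      record Continuation (x y z : Fin n) : Set where
        field
          next   : Fin n
          path   : InducedPath y z next
          colour : c y ≡ c z → c x ≡ c next → ⊥
      open Continuation

      -- The swap of y and z exchanges x with the next vertex and fixes everything else.
      continue : ∀ {x y z} → InducedPath x y z → Continuation x y z
      continue {x} {y} {z} P with swap (right P)
      ... | φ , p , q = record { next = u ; path = P′ ; colour = colour′ }
        where
        u = fun φ x

        -- The square of `φ` fixes both ends of the arc `y ~ z`, so it is the identity.
        φu≡x : fun φ u ≡ x
        φu≡x = ~-fixed (right P) (φ ∘ᴬ φ) (trans (cong (fun φ) p) q) (trans (cong (fun φ) q) p) x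

        P′ : InducedPath y z u
        P′ = record
          { left   = ~-sym (right P)
          ; right  = ~-map φ p refl (left P)
          ; ends-≢ = λ e → ends-≢ P (fun-injective φ (trans (sym e) (sym q)))
          ; ends-≁ = λ y~u → ends-≁ P (~-sym (~-preimage φ q refl y~u))
          }

        colour′ : c y ≡ c z → c x ≡ c u → ⊥
        colour′ cy≡cz cx≡cu = ~⇒≢ (right P) (trans (sym (dist φ preserves y)) p)
          where
          preserves : ∀ v → c (fun φ v) ≡ c v
          preserves v with position x z v | position y u v
          ... | first refl      | _               = sym cx≡cu
          ... | second refl     | _               = trans (cong c q) cy≡cz
          ... | neither _ _     | first refl      = trans (cong c p) (sym cy≡cz)
          ... | neither _ _     | second refl     = trans (cong c φu≡x) cx≡cu
          -- By `path-only`, `y` has only the neighbours `x` and `z`, and `z` only `y` and `u`; so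
          -- `v` is joined to neither end.
          ... | neither v≢x v≢z | neither v≢y v≢u = cong c (swap-fixes (right P)
            ([ v≢x , v≢z ]′ ∘ path-only P) ([ v≢y , v≢u ]′ ∘ path-only P′) v≢y v≢z φ p q)

      -- Since `z` has valency two, `u` is the vertex found by `continue`.
      consecutive-colours : ∀ {x y z u} → InducedPath x y z → InducedPath y z u →
        ¬ (c y ≡ c z × c x ≡ c u)
      consecutive-colours P Q (cy≡cz , cx≡cu) with continue P
      ... | C with path-only Q (right (path C))
      ...   | inj₁ e = ends-≢ (path C) (sym e)
      ...   | inj₂ e = colour C cy≡cz (trans cx≡cu (cong c (sym e)))

      -- In the 4-cycle `x` and `z` share their only `~`-neighbours `y` and `u`, and `y` has none
      -- besides `x` and `z`.
      opposite-twins : ∀ {x y z u} → InducedPath x y z → InducedPath y z u → InducedPath y x u → Twins G x z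
      opposite-twins P Q R = twins-criterion (left P) (right P)
        (λ _ _ x~v → [ (λ { refl → left Q }) , (λ { refl → right Q }) ]′ (path-only R x~v))
        (λ _ _ z~v → [ (λ { refl → left R }) , (λ { refl → right R }) ]′ (path-only Q z~v))
        (λ v≢x v≢z y~v → ⊥-elim ([ v≢x , v≢z ]′ (path-only P y~v)))

      no-4-cycle : ∀ {x y z u} → InducedPath x y z → InducedPath y z u → InducedPath y x u → ⊥
      no-4-cycle {x} {y} {z} {u} P Q R with 4-cycle-colouring (c x) (c y) (c z) (c u)
      ... | inj₁ e               = distinguishing⇒twins-differ (opposite-twins P Q R) dist (ends-≢ P) e
      ... | inj₂ (inj₁ e)        =
        distinguishing⇒twins-differ (opposite-twins Q U (InducedPath-sym P)) dist (ends-≢ Q) e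
        where
        -- The path centred at the fourth vertex: its arcs come from `Q` and `R`, its ends from `P`.
        U : InducedPath z u x
        U = record
          { left   = ~-sym (right Q)
          ; right  = ~-sym (right R)
          ; ends-≢ = ends-≢ P ∘ sym
          ; ends-≁ = ends-≁ P ∘ ~-sym
          }
      ... | inj₂ (inj₂ (inj₁ e)) = consecutive-colours P Q e
      ... | inj₂ (inj₂ (inj₂ e)) = consecutive-colours (InducedPath-sym P) R e

      no-5-cycle : ∀ {x y z u t} → InducedPath x y z → InducedPath y z u → InducedPath z u t →
        InducedPath u t x → InducedPath t x y → ⊥
      no-5-cycle {x} {y} {z} {u} {t} X Y Z U T with 5-cycle-colouring (c x) (c y) (c z) (c u) (c t)
      ... | inj₁ e                      = consecutive-colours X Y e
      ... | inj₂ (inj₁ e)               = consecutive-colours Y Z e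
      ... | inj₂ (inj₂ (inj₁ e))        = consecutive-colours Z U e
      ... | inj₂ (inj₂ (inj₂ (inj₁ e))) = consecutive-colours U T e
      ... | inj₂ (inj₂ (inj₂ (inj₂ e))) = consecutive-colours T X e

      -- The arcs of ~ have valency two and satisfy no-disjoint-arcs, so only C₄ and C₅ remain.
      no-induced-path : ∀ {x y z} → InducedPath x y z → ⊥
      no-induced-path {x} {y} {z} P with continue P | continue (InducedPath-sym P)
      -- The path is prolonged at both ends, to `u` after `z` and to `t` before `x`.
      ... | record { next = u ; path = Q } | record { next = t ; path = R } with u ≟ t
      ...   | yes refl = no-4-cycle P Q R
      ...   | no u≢t   = close (t ~? u)
        where
        z≢t : z ≢ t
        z≢t refl = ends-≁ P (right R)
        u≢x : u ≢ x
        u≢x refl = ends-≁ P (~-sym (right Q))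
        z≁t : ¬ z ~ t
        z≁t z~t = [ ends-≢ R ∘ sym , u≢t ∘ sym ]′ (path-only Q z~t)
        x≁u : ¬ x ~ u
        x≁u x~u = [ ends-≢ Q ∘ sym , u≢t ]′ (path-only R x~u)

        close : Dec (t ~ u) → ⊥
        -- Here no arc of `~` joins an end of `x ~ t` to an end of `z ~ u`.
        close (no t≁u)  = no-disjoint-arcs (right R) (right Q)
          (ends-≢ P ∘ sym) z≢t u≢x u≢t (ends-≁ P) (z≁t ∘ ~-sym) x≁u t≁u
        close (yes t~u) = no-5-cycle P Q
          (record { left = ~-sym (right Q) ; right = ~-sym t~u ; ends-≢ = z≢t ; ends-≁ = z≁t })
          (record { left = t~u ; right = ~-sym (right R) ; ends-≢ = u≢x ; ends-≁ = x≁u ∘ ~-sym })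
          (InducedPath-sym R)

      ~-closed : ∀ {x y z} → y ~ x → y ~ z → x ≢ z → x ~ z
      ~-closed {x} {y} {z} y~x y~z x≢z with x ~? z
      ... | yes x~z = x~z
      ... | no x≁z  = ⊥-elim (no-induced-path
        (record { left = y~x ; right = y~z ; ends-≢ = x≢z ; ends-≁ = x≁z }))

      -- By `~-closed` the component is complete, so `x` and `z` share all further `~`-neighbours
      -- and are twins in `G`.
      triangle-colours : ∀ {x y z} → y ~ x → y ~ z → x ~ z → c x ≢ c z
      triangle-colours y~x y~z x~z = distinguishing⇒twins-differ
        (twins-criterion y~x y~z
          (λ _ v≢z x~v → ~-closed x~z x~v (v≢z ∘ sym))
          (λ v≢x _ z~v → ~-closed (~-sym x~z) z~v (v≢x ∘ sym))
          (λ v≢x _ y~v → ~-closed y~x y~v (v≢x ∘ sym)))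
        dist (~⇒≢ x~z)

      -- A nontrivial automorphism fixing `a` must move `b`, and its image completes a triangle with
      -- `a` and `b`, which needs three colours.
      no-distinguishing : ⊥
      no-distinguishing with stabilizer (a ∷ []) (s≤s z≤n)
      ... | ψ , ψ≢id , stab with stab (here refl)
      ...   | here ψa = three-in-two
                (triangle-colours (~-sym b~d) (~-sym a~d) (~-sym a~b))
                (triangle-colours a~b a~d b~d)
                (triangle-colours (~-sym a~b) b~d a~d)
                (fin₂ (c b)) (fin₂ (c a)) (fin₂ (c (fun ψ b)))
        where
        a~d : a ~ fun ψ b
        a~d = ~-map ψ ψa refl a~b
        b~d : b ~ fun ψ b
        b~d = ~-closed a~b a~d (λ e → ψ≢id (base ψ ψa (sym e)))

-- Subsets and lists of vertices.

∣p∪q∣≤∣p∣+∣q∣ : (p q : Subset n) → ∣ p ∪ q ∣ ≤ ∣ p ∣ + ∣ q ∣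
∣p∪q∣≤∣p∣+∣q∣ []            []            = z≤n
∣p∪q∣≤∣p∣+∣q∣ (inside ∷ p)  (inside ∷ q)  =
  s≤s (≤-trans (∣p∪q∣≤∣p∣+∣q∣ p q) (+-monoʳ-≤ ∣ p ∣ (n≤1+n ∣ q ∣)))
∣p∪q∣≤∣p∣+∣q∣ (inside ∷ p)  (outside ∷ q) = s≤s (∣p∪q∣≤∣p∣+∣q∣ p q)
∣p∪q∣≤∣p∣+∣q∣ (outside ∷ p) (inside ∷ q)  =
  ≤-trans (s≤s (∣p∪q∣≤∣p∣+∣q∣ p q)) (≤-reflexive (sym (+-suc ∣ p ∣ ∣ q ∣)))
∣p∪q∣≤∣p∣+∣q∣ (outside ∷ p) (outside ∷ q) = ∣p∪q∣≤∣p∣+∣q∣ p q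

fromList : List (Fin n) → Subset n
fromList []      = ∅
fromList (x ∷ L) = ⁅ x ⁆ ∪ fromList L

∣fromList∣≤length : (L : List (Fin n)) → ∣ fromList L ∣ ≤ length L
∣fromList∣≤length {n} [] = ≤-reflexive (∣⊥∣≡0 n)
∣fromList∣≤length (x ∷ L) = begin
  ∣ ⁅ x ⁆ ∪ fromList L ∣     ≤⟨ ∣p∪q∣≤∣p∣+∣q∣ ⁅ x ⁆ (fromList L) ⟩
  ∣ ⁅ x ⁆ ∣ + ∣ fromList L ∣ ≡⟨ cong (_+ ∣ fromList L ∣) (∣⁅x⁆∣≡1 x) ⟩
  suc ∣ fromList L ∣         ≤⟨ s≤s (∣fromList∣≤length L) ⟩
  suc (length L)             ∎
  where open ≤-Reasoning

∈-fromList⁺ : ∀ {v} {L : List (Fin n)} → v ∈ₗ L → v ∈ fromList L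
∈-fromList⁺ {v = v} (here refl) = x∈p∪q⁺ (inj₁ (x∈⁅x⁆ v))
∈-fromList⁺ (there v∈L)         = x∈p∪q⁺ (inj₂ (∈-fromList⁺ v∈L))

∈-fromList⁻ : ∀ {v} (L : List (Fin n)) → v ∈ fromList L → v ∈ₗ L
∈-fromList⁻ []      v∈∅ = ⊥-elim (∉⊥ v∈∅)
∈-fromList⁻ (x ∷ L) v∈  =
  [ here ∘ x∈⁅y⁆⇒x≡y x , there ∘ ∈-fromList⁻ L ]′ (x∈p∪q⁻ ⁅ x ⁆ (fromList L) v∈)

elements : (S : Subset n) → ∃ λ L → length L ≡ ∣ S ∣ × (∀ {v} → v ∈ S → v ∈ₗ L)
elements []            = [] , refl , λ ()
elements (outside ∷ S) with elements S
... | L , len , ⊆L = map suc L , trans (length-map suc L) len , λ { (there v∈) → ∈-map⁺ suc (⊆L v∈) }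
elements (inside ∷ S)  with elements S
... | L , len , ⊆L = zero ∷ map suc L , cong suc (trans (length-map suc L) len) ,
  λ { here → here refl ; (there v∈) → there (∈-map⁺ suc (⊆L v∈)) }

-- Decidability by finite search.

anyVec? : ∀ {k m} {P : Vec (Fin k) m → Set} → (∀ v → Dec (P v)) → Dec (∃ P)
anyVec? {m = zero}  P? = map′ (λ p → [] , p) (λ { ([] , p) → p }) (P? [])
anyVec? {m = suc m} P? = map′ (λ { (i , v , p) → i ∷ v , p }) (λ { (i ∷ v , p) → i , v , p })
  (any? λ i → anyVec? λ v → P? (i ∷ v))

-- The search runs over value tables of the map and its inverse. A table gives back a function only
-- up to pointwise equality, hence the first hypothesis on `P`.
anyAut? : (G : Graph n) {P : (Fin n → Fin n) → Set} →
  (∀ {f g} → (∀ v → f v ≡ g v) → P f → P g) → (∀ f → Dec (P f)) →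
  Dec (Σ (Aut G) λ φ → P (fun φ))
anyAut? G {P} resp P? = map′ to from
  (anyVec? λ f → anyVec? λ g →
    all? (λ v → lookup g (lookup f v) ≟ v) ×-dec
    all? (λ v → lookup f (lookup g v) ≟ v) ×-dec
    all? (λ u → all? λ v → adj G (lookup f u) (lookup f v) Bool.≟ adj G u v) ×-dec
    P? (lookup f))
  where
  to : _ → _
  to (f , g , l , r , p , Pf) =
    record { fun = lookup f ; inv = lookup g ; inv-l = l ; inv-r = r ; preserv = p } , Pf
  from : _ → _
  from (φ , Pφ) = tabulate (fun φ) , tabulate (inv φ) ,
    (λ v → trans (t≗ (inv φ) _) (trans (cong (inv φ) (t≗ (fun φ) v)) (inv-l φ v))) ,
    (λ v → trans (t≗ (fun φ) _) (trans (cong (fun φ) (t≗ (inv φ) v)) (inv-r φ v))) ,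
    (λ u v → trans (cong₂ (adj G) (t≗ (fun φ) u) (t≗ (fun φ) v)) (preserv φ u v)) ,
    resp (λ v → sym (t≗ (fun φ) v)) Pφ
    where
    t≗ : (f : Fin _ → Fin _) → ∀ v → lookup (tabulate f) v ≡ f v
    t≗ = lookup∘tabulate

-- Rigid sets and distinguishing classes.

Rigid : Graph n → Subset n → Set
Rigid G S = ∀ (φ : Aut G) → (∀ v → lookup S (fun φ v) ≡ lookup S v) → IsIdentity φ

-- Phrased for bare maps so that `anyAut?` can search for it.
Breaks : Subset n → (Fin n → Fin n) → Set
Breaks S f = (∀ v → lookup S (f v) ≡ lookup S v) × ¬ (∀ v → f v ≡ v)

breaking? : (G : Graph n) (S : Subset n) → Dec (Σ (Aut G) λ φ → Breaks S (fun φ))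
breaking? G S = anyAut? G
  (λ f≗g (p , q) → (λ v → trans (cong (lookup S) (sym (f≗g v))) (p v)) ,
                   (λ r → q (λ v → trans (f≗g v) (r v))))
  (λ f → all? (λ v → lookup S (f v) Bool.≟ lookup S v) ×-dec ¬? (all? λ v → f v ≟ v))

¬breaking⇒rigid : (G : Graph n) (S : Subset n) → ¬ (Σ (Aut G) λ φ → Breaks S (fun φ)) → Rigid G S
¬breaking⇒rigid G S none φ p =
  decidable-stable (all? λ v → fun φ v ≟ v) (λ q → none (φ , p , q))

rigid? : (G : Graph n) (S : Subset n) → Dec (Rigid G S)
rigid? G S with breaking? G S
... | yes (φ , p , q) = no (λ rigid → q (rigid φ p))
... | no none         = yes (¬breaking⇒rigid G S none)

-- With two colours, the other class is the complement of class `i`.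
⌊≟⌋-injective : (i p q : Fin 2) → ⌊ p ≟ i ⌋ ≡ ⌊ q ≟ i ⌋ → p ≡ q
⌊≟⌋-injective = toWitness
  {a? = all? λ i → all? λ p → all? λ q → (⌊ p ≟ i ⌋ Bool.≟ ⌊ q ≟ i ⌋) →-dec (p ≟ q)} tt

distClass⇒rigid : {G : Graph n} {S : Subset n} → DistClass G S → Rigid G S
distClass⇒rigid (c , dist , i , refl) φ p = dist φ λ v → ⌊≟⌋-injective i _ _
  (trans (sym (lookup∘tabulate _ (fun φ v))) (trans (p v) (lookup∘tabulate _ v)))

toColour : Bool → Fin 2
toColour true  = zero
toColour false = suc zero

⌊toColour≟0⌋ : ∀ s → ⌊ toColour s ≟ zero ⌋ ≡ s
⌊toColour≟0⌋ true  = refl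
⌊toColour≟0⌋ false = refl

rigid⇒distClass : {G : Graph n} {S : Subset n} → Rigid G S → DistClass G S
rigid⇒distClass {S = S} rigid = toColour ∘ lookup S ,
  (λ φ p → rigid φ λ v → trans (sym (⌊toColour≟0⌋ _))
    (trans (cong (λ i → ⌊ i ≟ zero ⌋) (p v)) (⌊toColour≟0⌋ _))) ,
  zero , trans (tabulate-cong (⌊toColour≟0⌋ ∘ lookup S)) (tabulate∘lookup S)

-- Fixing `S` pointwise implies preserving it setwise, so `rigid` applies.
rigid⇒determining : {G : Graph n} {S : Subset n} → Rigid G S → Determining G S
rigid⇒determining {S = S} rigid φ fixes = rigid φ preserves
  where
  preserves : ∀ v → lookup S (fun φ v) ≡ lookup S v
  preserves v with lookup S v in v∈ | lookup S (fun φ v) in φv∈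
  ... | true  | true  = refl
  ... | false | false = refl
  ... | true  | false =
    trans (sym φv∈) (trans (cong (lookup S) (fixes v (lookup⇒[]= v S v∈))) v∈)
  -- Here `φ` fixes `fun φ v`, which lies in `S`; by injectivity it fixes `v`.
  ... | false | true  =
    trans (sym φv∈) (trans (cong (lookup S) (fun-injective φ (fixes (fun φ v) (lookup⇒[]= _ S φv∈)))) v∈)

-- The least size of a rigid set.

least : {P : ℕ → Set} → (∀ m → Dec (P m)) → ∀ m → P m → ∃ λ r → P r × r ≤ m × (∀ j → P j → r ≤ j)
least {P} P? = <-rec _ step
  where
  step : ∀ m → (∀ {k} → k < m → P k → ∃ λ r → P r × r ≤ k × (∀ j → P j → r ≤ j)) →
    P m → ∃ λ r → P r × r ≤ m × (∀ j → P j → r ≤ j)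
  step m rec Pm with anyUpTo? P? m
  ... | no none = m , Pm , ≤-refl , λ j Pj → ≮⇒≥ (λ j<m → none (j , j<m , Pj))
  ... | yes (k , k<m , Pk) with rec k<m Pk
  ...   | r , Pr , r≤k , min = r , Pr , ≤-trans r≤k (<⇒≤ k<m) , min

-- Either a search over all subsets finds `T`, or its failure supplies the hypothesis `stabilizer`
-- of `Arcs`, which contradicts `dist`.
small-rigid : (G : Graph n) {c : Fin n → Fin 2} → Distinguishing G c →
  (S : Subset n) → Determining G S → ∣ S ∣ ≡ 2 → ∃ λ T → Rigid G T × ∣ T ∣ ≤ 4
small-rigid G dist S det ∣S∣≡2 with anySubset? (λ T → rigid? G T ×-dec (∣ T ∣ ≤? 4)) | elements S
... | yes found | _ = found
... | no none | []            , len , _  = contradiction (trans len ∣S∣≡2) λ ()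
... | no none | _ ∷ []        , len , _  = contradiction (trans len ∣S∣≡2) λ ()
... | no none | _ ∷ _ ∷ _ ∷ _ , len , _  = contradiction (trans len ∣S∣≡2) λ ()
... | no none | a ∷ b ∷ []    , len , ⊆L = ⊥-elim (no-distinguishing _~?_ dist)
  where
  base : ∀ (φ : Aut G) → fun φ a ≡ a → fun φ b ≡ b → IsIdentity φ
  base φ p q = det φ λ v v∈S → fixes (⊆L v∈S)
    where
    fixes : ∀ {v} → v ∈ₗ a ∷ b ∷ [] → fun φ v ≡ v
    fixes (here refl)         = p
    fixes (there (here refl)) = q

  stabilizer : ∀ L → length L ≤ 4 →
    Σ (Aut G) λ ψ → ¬ IsIdentity ψ × (∀ {v} → v ∈ₗ L → fun ψ v ∈ₗ L)
  stabilizer L len≤4 with breaking? G (fromList L)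
  -- `L` may repeat vertices, so its length only bounds the size of its set.
  ... | no rigid = ⊥-elim (none
    (fromList L , ¬breaking⇒rigid G (fromList L) rigid , ≤-trans (∣fromList∣≤length L) len≤4))
  ... | yes (ψ , p , q) = ψ , q , λ {v} v∈ → ∈-fromList⁻ L
    (lookup⇒[]= _ (fromList L) (trans (p v) ([]=⇒lookup (∈-fromList⁺ v∈))))

  open Arcs G a b base stabilizer

  _~?_ : ∀ x y → Dec (x ~ y)
  x ~? y = anyAut? G (λ f≗g (p , q) → trans (sym (f≗g a)) p , trans (sym (f≗g b)) q)
    (λ f → (f a ≟ x) ×-dec (f b ≟ y))

mainTheorem1 : ∀ {n : ℕ} (G : Graph n) → DistNumberIs G 2 → DetNumberIs G 2 →
    Σ ℕ (λ r → CostNumberIs G r × 2 ≤ r × r ≤ 4)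
mainTheorem1 G ((c , dist) , _) ((S , det , ∣S∣≡2) , det-min) with small-rigid G dist S det ∣S∣≡2
... | T , rigid , ∣T∣≤4
  -- `T` witnesses that some size occurs; the least one is the cost and inherits the bound four.
  with least (λ r → anySubset? λ S → rigid? G S ×-dec (∣ S ∣ ≟ℕ r)) ∣ T ∣ (T , rigid , refl)
...   | r , (R , rigidR , refl) , r≤∣T∣ , r-min =
  r ,
  ((R , rigid⇒distClass rigidR , refl) , λ S′ dc → r-min ∣ S′ ∣ (S′ , distClass⇒rigid dc , refl)) ,
  -- The lower bound: `R` is determining, and determining sets have at least two elements.
  det-min R (rigid⇒determining rigidR) ,
  ≤-trans r≤∣T∣ ∣T∣≤4
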